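{- Let $s,r,R$ be positive integers with $s\ge 2$, and let $\delta=(r+1)(R+1)-sr-1$. Suppose $\delta\ge 1$ and $R+1\le sr$ (so that $B(R)\neq\mathbb F_q^{s\times r}$). Then there exists an $R$-sticky vector $m\in\mathbb F_q^{s\times r}$ for $B(R)$; i.e. there is $m\notin B(R)$ such that every ball $B(c,R)$ containing $m$ intersects $B(R)$. Consequently, for $\delta\ge 1$ there are no non-trivial $R$-perfect codes in $\mathbb F_q^{s\times r}$ with respect to the NRT metric.
   Context: $q$ is a prime power, $\mathbb F_q^{s\times r}$ the set of $s\times r$ matrices over $\mathbb F_q$ with rows $x_1,\dots,x_s\in\mathbb F_q^{1\times r}$. For a row $y=(y_1,\dots,y_r)$, the NRT weight is $w(y)=\max\{j: y_j\neq 0\}$ if $y\neq 0$ and $w(0)=0$; for a matrix $x$, $w(x)=\sum_i w(x_i)$. The NRT metric is $d(x,y)=w(x-y)$; $B(c,R)=\{x: d(x,c)\le R\}$, $B(R)=B(0,R)$. The $R$-closure of $S$ is the set of points $p$ such that every ball of radius $R$ containing $p$ contains some point of $S$; elements of the $R$-closure of $S$ not in $S$ are called $R$-sticky vectors for $S$. A code $C\subseteq\mathbb F_q^{s\times r}$ is $R$-perfect if the balls $B(c,R)$, $c\in C$, are pairwise disjoint and cover $\mathbb F_q^{s\times r}$; it is non-trivial if $|C|>1$ and $C\ne\mathbb F_q^{s\times r}$. -}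

module Defs where

open import Level using (Level; suc; _⊔_)
open import Algebra.Bundles using (CommutativeRing)
open import Algebra.Properties.Monoid.Sum using (sum)
open import Data.Fin.Base using (Fin; toℕ)
import Data.Fin.Properties as Fin
open import Data.Integer.Base as ℤ using (ℤ)
open import Data.List.Base using (map; filter; allFin)
open import Data.List.Extrema.Nat using (max)
open import Data.Nat.Base as ℕ using (ℕ)
open import Data.Nat.Primality using (Prime)
open import Data.Nat.Properties using (+-0-monoid)
open import Data.Product.Base using (∃; ∃₂; _×_)
open import Data.Vec.Functional using (Vector; zipWith)
open import Data.Vec.Functional.Relation.Binary.Pointwise using (Pointwise)
open import Function.Bundles using (Inverse)
open import Function.Properties.Inverse using (Inverse⇒Injection)
open import Relation.Binary.Core using (Rel)
open import Relation.Binary.Definitions using (Decidable)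
open import Relation.Binary.PropositionalEquality using (_≡_; setoid)
open import Relation.Nullary using (¬_)
open import Relation.Nullary.Decidable using (¬?; via-injection)
open import Relation.Unary using (Pred; _∈_; _∉_; _≬_; _⊥_; Universal)

IsPrimePower : ℕ → Set
IsPrimePower q = ∃₂ λ p k → Prime p × 1 ℕ.≤ k × q ≡ p ℕ.^ k

record FiniteField (c ℓ : Level) (q : ℕ) : Set (suc (c ⊔ ℓ)) where
  field
    commutativeRing : CommutativeRing c ℓ

  open CommutativeRing commutativeRing public
    renaming (setoid to ≈-setoid)

  field
    0≉1         : ¬ (0# ≈ 1#)
    inverse     : ∀ x → ¬ (x ≈ 0#) → ∃ λ y → x * y ≈ 1#
    enumeration : Inverse ≈-setoid (setoid (Fin q))

  infix 4 _≟_
  _≟_ : Decidable _≈_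
  _≟_ = via-injection (Inverse⇒Injection enumeration) Fin._≟_

-- An integer, since the difference can be negative.
δ : (s r R : ℕ) → ℤ
δ s r R = ℤ.+ ((r ℕ.+ 1) ℕ.* (R ℕ.+ 1)) ℤ.- ℤ.+ (s ℕ.* r) ℤ.- ℤ.1ℤ

module NRT {c ℓ : Level} {q : ℕ} (F : FiniteField c ℓ q) where
  open FiniteField F

  Row : ℕ → Set c
  Row r = Vector Carrier r

  Matrix : ℕ → ℕ → Set c
  Matrix s r = Vector (Row r) s

  infix 4 _≈ᴹ_
  _≈ᴹ_ : ∀ {s r} → Rel (Matrix s r) ℓ
  _≈ᴹ_ = Pointwise (Pointwise _≈_)

  infixl 6 _-ᴹ_
  _-ᴹ_ : ∀ {s r} → Matrix s r → Matrix s r → Matrix s r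
  _-ᴹ_ = zipWith (zipWith _-_)

  0ᴹ : ∀ {s r} → Matrix s r
  0ᴹ _ _ = 0#

  -- Coordinates are numbered from 1, so i : Fin r contributes toℕ i + 1;
  -- the base value 0 of max gives the weight of the zero row.
  rowWeight : ∀ {r} → Row r → ℕ
  rowWeight {r} y =
    max 0 (map (λ i → ℕ.suc (toℕ i)) (filter (λ i → ¬? (y i ≟ 0#)) (allFin r)))

  weight : ∀ {s r} → Matrix s r → ℕ
  weight x = sum +-0-monoid (λ i → rowWeight (x i))

  dist : ∀ {s r} → Matrix s r → Matrix s r → ℕ
  dist x y = weight (x -ᴹ y)

  Ball : ∀ {s r} → Matrix s r → ℕ → Pred (Matrix s r) _
  Ball z R x = dist x z ℕ.≤ R

  Closure : ∀ {s r a} → ℕ → Pred (Matrix s r) a → Pred (Matrix s r) _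
  Closure R S p = ∀ z → p ∈ Ball z R → Ball z R ≬ S

  Sticky : ∀ {s r a} → ℕ → Pred (Matrix s r) a → Pred (Matrix s r) _
  Sticky R S p = p ∈ Closure R S × p ∉ S

  Perfect : ∀ {s r a} → ℕ → Pred (Matrix s r) a → Set _
  Perfect R C =
    (∀ x y → x ∈ C → y ∈ C → ¬ (x ≈ᴹ y) → Ball x R ⊥ Ball y R) ×
    (∀ p → ∃ λ x → x ∈ C × p ∈ Ball x R)

  -- |C| > 1 is expressed as the existence of two distinct codewords.
  NonTrivial : ∀ {s r a} → Pred (Matrix s r) a → Set _
  NonTrivial C =
    (∃₂ λ x y → x ∈ C × y ∈ C × ¬ (x ≈ᴹ y)) × ¬ Universal C

{-# OPTIONS --safe #-}
-- Weights are chosen rather than vectors: take row weights a with ∑ a = R + 1,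
-- a₀ > 0 and a₀ + r · #{i > 0 : aᵢ = 0} ≤ R, which is where δ ≥ 1 enters, and
-- let m be any matrix with these row weights.  Suppose d(m , c) ≤ R.  A row of
-- c with weight bᵢ ≠ aᵢ costs at least bᵢ by the ultrametric inequality.
-- If bᵢ ≠ aᵢ for some i with aᵢ > 0, keep exactly the rows of c with bᵢ = aᵢ:
-- the kept rows weigh less than ∑ a, the others at most d(m , c).  Otherwise
-- keep the rows i > 0 with aᵢ > 0: they weigh R + 1 - a₀, and the remaining ones
-- at most a₀ + r · #{i > 0 : aᵢ = 0}.
-- Translated to a codeword x₀, a sticky vector lies in no ball around another
-- codeword (such a ball meets that of x₀) nor in the ball of x₀ itself.
module Submission where

open import Defs
open import Level using (Level)
open import Data.Integer.Base as ℤ using (ℤ)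
open import Data.Nat.Base using (ℕ; _+_; _*_; _≤_)
open import Data.Product.Base using (∃; _×_)
open import Relation.Binary.Definitions using (_Respects_)
open import Relation.Nullary using (¬_)
open import Relation.Unary using (Pred)

open import Algebra.Properties.Monoid.Sum using (sum)
import Algebra.Properties.AbelianGroup as AbelianGroupProperties
open import Data.Bool.Base using (true; false; if_then_else_; T)
open import Data.Fin.Base using (Fin; zero; suc; toℕ; fromℕ<)
open import Data.Fin.Properties using (any?; toℕ<n; toℕ-fromℕ<)
import Data.Integer.Properties as ℤ
open import Data.List.Base using (allFin; map; filter)
open import Data.List.Extrema.Nat using (max≤v⁺; xs≤max)
open import Data.List.Membership.Propositional.Properties using (∈-allFin; ∈-filter⁺)
import Data.List.Relation.Unary.All as All
import Data.List.Relation.Unary.All.Properties as All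
open import Data.Nat.Base using (zero; suc; _<_; _∸_; _⊔_; _≡ᵇ_; z≤n; s≤s)
open import Data.Nat.Properties renaming (_≟_ to _≟ᴺ_)
open import Data.Product.Base using (_,_; proj₁; proj₂)
open import Data.Sum.Base using (_⊎_; inj₁; inj₂)
open import Data.Vec.Functional using (Vector; []; _∷_; zipWith)
open import Data.Vec.Functional.Relation.Binary.Pointwise.Properties using (decidable)
open import Function.Base using (_∘_)
open import Relation.Binary.Definitions using (tri<; tri≈; tri>)
open import Relation.Binary.PropositionalEquality as ≡ using (_≡_; _≢_; refl; cong; subst)
open import Relation.Nullary.Decidable using (Dec; yes; no; ¬?; _×-dec_)
open import Relation.Nullary.Negation using (contradiction)
open import Relation.Unary using (_∈_)

-- Sums of natural numbers.

∑ : ∀ {n} → Vector ℕ n → ℕ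
∑ = sum +-0-monoid

∑-mono-≤ : ∀ {n} {f g : Vector ℕ n} → (∀ i → f i ≤ g i) → ∑ f ≤ ∑ g
∑-mono-≤ {zero}  f≤g = z≤n
∑-mono-≤ {suc n} f≤g = +-mono-≤ (f≤g zero) (∑-mono-≤ (f≤g ∘ suc))

∑-mono-< : ∀ {n} {f g : Vector ℕ n} → (∀ i → f i ≤ g i) →
           ∀ i → f i < g i → ∑ f < ∑ g
∑-mono-< f≤g zero    f<g = +-mono-<-≤ f<g (∑-mono-≤ (f≤g ∘ suc))
∑-mono-< f≤g (suc i) f<g = +-mono-≤-< (f≤g zero) (∑-mono-< (f≤g ∘ suc) i f<g)

∑-bound : ∀ {n k} {f : Vector ℕ n} → (∀ i → f i ≤ k) → ∑ f ≤ n * k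
∑-bound {zero}  f≤k = z≤n
∑-bound {suc n} f≤k = +-mono-≤ (f≤k zero) (∑-bound (f≤k ∘ suc))

m≤n⊔o∧n<m⇒m≤o : ∀ {m n o} → m ≤ n ⊔ o → n < m → m ≤ o
m≤n⊔o∧n<m⇒m≤o {m} {n} {o} m≤n⊔o n<m with ⊔-sel n o
... | inj₁ eq = contradiction (subst (m ≤_) eq m≤n⊔o) (<⇒≱ n<m)
... | inj₂ eq = subst (m ≤_) eq m≤n⊔o

-- Row weight profiles with few zero rows.

-- Bounds the cost of a row of `c` below the head when `c` matches all positive weights of `m`:
-- facing a zero row it is dropped and may weigh up to `r`, otherwise it is kept.
slack : ℕ → ℕ → ℕ
slack r zero    = r
slack r (suc _) = 0

slack-pos : ∀ {r k} → 1 ≤ k → slack r k ≡ 0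
slack-pos (s≤s _) = refl

record Profile (r n N σ : ℕ) : Set where
  constructor profile
  field
    rows    : Vector ℕ n
    bounded : ∀ i → rows i ≤ r
    total   : ∑ rows ≡ N
    slacks  : ∑ (slack r ∘ rows) ≤ σ

-- `size` serves to bound head plus slacks: either the head is as small as possible, or the rows
-- after it are full and none of them is zero.
record PositiveHead (r n N : ℕ) : Set where
  field
    head rest : ℕ
    1≤head    : 1 ≤ head
    head≤r    : head ≤ r
    total     : head + rest ≡ suc N
    size      : head ≡ 1 ⊎ (n * r ≤ N × rest ≡ n * r)
    tail      : Profile r n rest (r * (n ∸ N))

-- To have as few zero rows as possible, each row in turn gets the least positive
-- weight that lets the later rows hold the rest.
mutual
  spread : ∀ r → 1 ≤ r → ∀ n N → N ≤ n * r → Profile r n N (r * (n ∸ N))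
  spread r 1≤r zero    zero    _ = profile [] (λ ()) refl z≤n
  spread r 1≤r (suc n) zero    _ with profile a a≤r ∑a s ← spread r 1≤r n 0 z≤n =
    profile (0 ∷ a) (λ { zero → z≤n ; (suc i) → a≤r i }) ∑a
      (subst (r + ∑ (slack r ∘ a) ≤_) (≡.sym (*-suc r n)) (+-monoʳ-≤ r s))
  spread r 1≤r (suc n) (suc N) N≤ =
    profile (head ∷ rows)
      (λ { zero → head≤r ; (suc i) → bounded i })
      (≡.trans (cong (head +_) ∑rows) total)
      -- A positive head has no slack, and `suc n ∸ suc N` reduces to `n ∸ N`, so the bound for the
      -- tail suffices.
      (subst (λ k → k + ∑ (slack r ∘ rows) ≤ r * (n ∸ N)) (≡.sym (slack-pos 1≤head)) slacks)
    where
    open PositiveHead (positiveHead r 1≤r n N N≤)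
    open Profile tail renaming (total to ∑rows)

  positiveHead : ∀ r → 1 ≤ r → ∀ n N → suc N ≤ suc n * r → PositiveHead r n N
  positiveHead r 1≤r n N N<  with N ≤? n * r
  ... | yes N≤nr = record
    { head = 1 ; rest = N ; 1≤head = ≤-refl ; head≤r = 1≤r ; total = refl
    ; size = inj₁ refl ; tail = spread r 1≤r n N N≤nr }
  ... | no N≰nr = record
    { head = suc N ∸ n * r ; rest = n * r
    ; 1≤head = m<n⇒0<n∸m (m<n⇒m<1+n nr<N)
    ; head≤r = m≤n+o⇒m∸n≤o (suc N) (n * r) (subst (suc N ≤_) (+-comm r (n * r)) N<)
    ; total = m∸n+n≡m (m≤n⇒m≤1+n (<⇒≤ nr<N))
    ; size = inj₂ (<⇒≤ nr<N , refl)
    -- As `n ≤ n * r ≤ N`, the bounds for the totals `n * r` and `N` are both 0.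
    ; tail = record { Profile P hiding (slacks)
                    ; slacks = subst (λ k → ∑ (slack r ∘ Profile.rows P) ≤ r * k)
                        (≡.trans (m≤n⇒m∸n≡0 n≤nr) (≡.sym (m≤n⇒m∸n≡0 n≤N))) (Profile.slacks P) } }
    where
    nr<N = ≰⇒> N≰nr
    n≤nr : n ≤ n * r
    n≤nr = subst (_≤ n * r) (*-identityʳ n) (*-monoʳ-≤ n 1≤r)
    n≤N = ≤-trans n≤nr (<⇒≤ nr<N)
    P = spread r 1≤r n (n * r) ≤-refl

-- The condition on `δ` in natural numbers.

i≤j-k⇒i+k≤j : ∀ {i j k} → i ℤ.≤ j ℤ.- k → i ℤ.+ k ℤ.≤ j
i≤j-k⇒i+k≤j {i} {j} {k} p =
  subst (i ℤ.+ k ℤ.≤_) (//-rightDividesˡ k j) (ℤ.+-monoˡ-≤ k p)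
  where open AbelianGroupProperties ℤ.+-0-abelianGroup

δ≥1⇒ : ∀ s r R → ℤ.1ℤ ℤ.≤ δ s r R → 2 + s * r ≤ (r + 1) * (R + 1)
δ≥1⇒ s r R 1≤δ = ℤ.drop‿+≤+ (i≤j-k⇒i+k≤j {k = ℤ.+ (s * r)} (i≤j-k⇒i+k≤j {k = ℤ.1ℤ} 1≤δ))

-- For s = n + 1, the inequality r · (n - R) < R is δ ≥ 1.
δ≥1⇒zeroRows : ∀ n r R → 1 ≤ R → ℤ.1ℤ ℤ.≤ δ (suc n) r R → suc (r * (n ∸ R)) ≤ R
δ≥1⇒zeroRows n r R@(suc R′) _ 1≤δ = s≤s (begin
  r * (n ∸ R)     ≡⟨ *-distribˡ-∸ r n R ⟩
  r * n ∸ r * R   ≤⟨ m≤n+o⇒m∸n≤o (r * n) (r * R) rn≤ ⟩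
  R′              ∎)
  where
  open ≤-Reasoning
  expand : (r + 1) * (R + 1) ≡ (2 + r) + (r * R + R′)
  expand = solve 2 (λ r R′ → (r :+ con 1) :* ((con 1 :+ R′) :+ con 1) :=
     (con 2 :+ r) :+ (r :* (con 1 :+ R′) :+ R′)) refl r R′
    where open import Data.Nat.Solver; open +-*-Solver
  rn≤ : r * n ≤ r * R + R′
  -- Splitting one `r` off `s * r` and expanding the product puts `2 + r` on both sides of `δ≥1⇒`.
  rn≤ = +-cancelˡ-≤ (2 + r) _ _ (begin
    2 + r + r * n         ≡⟨ cong (2 + r +_) (*-comm r n) ⟩
    2 + (r + n * r)       ≤⟨ δ≥1⇒ (suc n) r R 1≤δ ⟩
    (r + 1) * (R + 1)     ≡⟨ expand ⟩
    2 + r + (r * R + R′)  ∎)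

-- Row weights and the ultrametric inequality.

module _ {c ℓ} {q : ℕ} (F : FiniteField c ℓ q) where
  open FiniteField F
    using (_≈_; _≟_; 0#; 1#; -_; _-_; 0≉1; +-congˡ; -‿cong; +-abelianGroup)
    renaming
    ( _+_ to _+ᶠ_; refl to ≈-refl; sym to ≈-sym; trans to ≈-trans
    ; +-assoc to +ᶠ-assoc; +-identityʳ to +ᶠ-identityʳ )
  open NRT F
  open AbelianGroupProperties +-abelianGroup using
    ( //-rightDividesʳ; ⁻¹-anti-homo-//; x∙y⁻¹≈ε⇒x≈y; ε⁻¹≈ε; x≈y⇒x∙y⁻¹≈ε )

  _-ᴿ_ : ∀ {r} → Row r → Row r → Row r
  _-ᴿ_ = zipWith _-_

  0ᴿ : ∀ {r} → Row r
  0ᴿ _ = 0#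

  -- Index `i` is coordinate `toℕ i + 1`, so `t ≤ toℕ i` means beyond coordinate `t`. With
  -- `rowWeight-vanish` this characterises the weight without unfolding the maximum.
  rowWeight≤ : ∀ {r t} (y : Row r) → (∀ i → t ≤ toℕ i → y i ≈ 0#) → rowWeight y ≤ t
  rowWeight≤ {r} {t} y vanish = max≤v⁺ z≤n (All.map⁺ (All.map bound (All.all-filter nonzero? (allFin r))))
    where
    nonzero? = λ i → ¬? (y i ≟ 0#)
    bound : ∀ {i} → ¬ (y i ≈ 0#) → suc (toℕ i) ≤ t
    bound {i} yi≉0 = ≰⇒> (yi≉0 ∘ vanish i)

  rowWeight-vanish : ∀ {r} (y : Row r) i → rowWeight y ≤ toℕ i → y i ≈ 0#
  rowWeight-vanish {r} y i w≤i with y i ≟ 0#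
  ... | yes yi≈0 = yi≈0
  ... | no  yi≉0 = contradiction w≤i (<⇒≱
    (All.lookup (All.map⁻ (xs≤max 0 (map (suc ∘ toℕ) (filter nonzero? (allFin r)))))
      (∈-filter⁺ nonzero? (∈-allFin i) yi≉0)))
    where nonzero? = λ i → ¬? (y i ≟ 0#)

  rowWeight≤r : ∀ {r} (y : Row r) → rowWeight y ≤ r
  rowWeight≤r y = rowWeight≤ y λ i r≤i → contradiction (toℕ<n i) (≤⇒≯ r≤i)

  rowWeight-cong : ∀ {r} {x y : Row r} → (∀ i → x i ≈ y i) → rowWeight x ≤ rowWeight y
  rowWeight-cong {x = x} {y} x≈y =
    rowWeight≤ x λ i w≤i → ≈-trans (x≈y i) (rowWeight-vanish y i w≤i)

  weight-cong : ∀ {s r} {x y : Matrix s r} → x ≈ᴹ y → weight x ≤ weight y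
  weight-cong x≈y = ∑-mono-≤ λ i → rowWeight-cong (x≈y i)

  rowWeight-x-x : ∀ {r k} (x : Row r) → rowWeight (x -ᴿ x) ≤ k
  rowWeight-x-x {k = k} x = ≤-trans {j = 0} (rowWeight≤ (x -ᴿ x) λ i _ → x≈y⇒x∙y⁻¹≈ε ≈-refl) z≤n

  x-0≈x : ∀ x → x - 0# ≈ x
  x-0≈x x = ≈-trans (+-congˡ ε⁻¹≈ε) (+ᶠ-identityʳ x)

  rowWeight-x-0 : ∀ {r} (x : Row r) → rowWeight (x -ᴿ 0ᴿ) ≤ rowWeight x
  rowWeight-x-0 x = rowWeight-cong λ i → x-0≈x (x i)

  rowWeight-0-x : ∀ {r} (x : Row r) → rowWeight (0ᴿ -ᴿ x) ≤ rowWeight x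
  rowWeight-0-x x = rowWeight≤ (0ᴿ -ᴿ x) λ i w≤i →
    x≈y⇒x∙y⁻¹≈ε (≈-sym (rowWeight-vanish x i w≤i))

  module _ {r} (x y : Row r) where
    private
      agree : ∀ {k} j → k ⊔ rowWeight (x -ᴿ y) ≤ toℕ j → x j ≈ y j
      agree {k} j w≤j = x∙y⁻¹≈ε⇒x≈y (x j) (y j)
        (rowWeight-vanish (x -ᴿ y) j (m⊔n≤o⇒n≤o k _ w≤j))

    -- Beyond both the lighter weight `k` and the weight of the difference, the rows agree and the
    -- lighter one vanishes, hence so does the heavier. Its weight exceeds `k`, so the difference
    -- must account for it.
    rowWeight-≢ : rowWeight x ≢ rowWeight y → rowWeight y ≤ rowWeight (x -ᴿ y)
    rowWeight-≢ wx≢wy with <-cmp (rowWeight x) (rowWeight y)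
    ... | tri< wx<wy _ _ = m≤n⊔o∧n<m⇒m≤o (rowWeight≤ y λ j w≤j →
      ≈-trans (≈-sym (agree j w≤j)) (rowWeight-vanish x j (m⊔n≤o⇒m≤o _ _ w≤j))) wx<wy
    ... | tri≈ _ wx≡wy _ = contradiction wx≡wy wx≢wy
    ... | tri> _ _ wy<wx = ≤-trans (<⇒≤ wy<wx) (m≤n⊔o∧n<m⇒m≤o (rowWeight≤ x λ j w≤j →
      ≈-trans (agree j w≤j) (rowWeight-vanish y j (m⊔n≤o⇒m≤o _ _ w≤j))) wy<wx)

  -- For `k = 0` the test always fails, which yields the zero row.
  unit : ∀ {r} → ℕ → Row r
  unit k j = if k ≡ᵇ suc (toℕ j) then 1# else 0#

  rowWeight-unit : ∀ {r k} → k ≤ r → rowWeight (unit {r} k) ≡ k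
  rowWeight-unit {r} {k} k≤r = ≤-antisym (rowWeight≤ (unit {r} k) upper) (lower k k≤r)
    where
    upper : ∀ (j : Fin r) → k ≤ toℕ j → unit k j ≈ 0#
    upper j k≤j with k ≡ᵇ suc (toℕ j) in eq
    ... | true  = contradiction k≤j (<⇒≱ (≤-reflexive (≡.sym (≡ᵇ⇒≡ k _ (subst T (≡.sym eq) _)))))
    ... | false = ≈-refl
    lower : ∀ k → k ≤ r → k ≤ rowWeight (unit {r} k)
    lower zero    _   = z≤n
    lower (suc k) k<r = ≰⇒> λ w≤k → 0≉1 (≈-sym (≈-trans (≈-sym one)
        (rowWeight-vanish (unit (suc k)) j (≤-trans w≤k (≤-reflexive (≡.sym (toℕ-fromℕ< k<r)))))))
      where
      j = fromℕ< k<r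
      one : unit (suc k) j ≈ 1#
      one with suc k ≡ᵇ suc (toℕ j) | ≡⇒≡ᵇ (suc k) (suc (toℕ j)) (cong suc (≡.sym (toℕ-fromℕ< k<r)))
      ... | true | _ = ≈-refl

  -- Row weights that force stickiness.

  keep : ∀ {p r} {P : Set p} → Dec P → Row r → Row r
  keep (yes _) y = y
  keep (no  _) y = 0ᴿ

  sticky : ∀ {n r R} (m : Matrix (suc n) r) → weight m ≡ suc R →
           0 < rowWeight (m zero) →
           rowWeight (m zero) + ∑ (slack r ∘ rowWeight ∘ m ∘ suc) ≤ R →
           Sticky R (Ball 0ᴹ R) m
  sticky {n} {r} {R} m wm≡ 0<m₀ few = closure , outside
    where
    outside : ¬ (m ∈ Ball 0ᴹ R)
    outside m∈B = contradiction
      (≤-trans (weight-cong λ i j → ≈-sym (x-0≈x (m i j))) m∈B)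
      (subst (λ k → ¬ (k ≤ R)) (≡.sym wm≡) 1+n≰n)

    -- `m` weighs `R + 1`, so anything strictly lighter lies in the ball around 0.
    below : ∀ {k} → k < weight m → k ≤ R
    below k<w = ≤-pred (<-≤-trans k<w (≤-reflexive wm≡))

    closure : m ∈ Closure R (Ball 0ᴹ R)
    closure c m∈B
      with any? (λ i → (0 <? rowWeight (m i)) ×-dec ¬? (rowWeight (m i) ≟ᴺ rowWeight (c i)))
    ... | yes (k , 0<mₖ , mₖ≢cₖ) =
      z , ≤-trans (∑-mono-≤ far) m∈B , below (∑-mono-< near k strict)
      where
      z : Matrix (suc n) r
      z i = keep (rowWeight (m i) ≟ᴺ rowWeight (c i)) (c i)

      near : ∀ i → rowWeight (z i -ᴿ 0ᴿ) ≤ rowWeight (m i)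
      near i with rowWeight (m i) ≟ᴺ rowWeight (c i)
      ... | yes mᵢ≡cᵢ = ≤-trans (rowWeight-x-0 (c i)) (≤-reflexive (≡.sym mᵢ≡cᵢ))
      ... | no  _     = rowWeight-x-x {r} 0ᴿ

      strict : rowWeight (z k -ᴿ 0ᴿ) < rowWeight (m k)
      strict with rowWeight (m k) ≟ᴺ rowWeight (c k)
      ... | yes mₖ≡cₖ = contradiction mₖ≡cₖ mₖ≢cₖ
      ... | no  _     = ≤-<-trans (rowWeight-x-x {r} 0ᴿ) 0<mₖ

      far : ∀ i → rowWeight (z i -ᴿ c i) ≤ rowWeight (m i -ᴿ c i)
      far i with rowWeight (m i) ≟ᴺ rowWeight (c i)
      ... | yes _     = rowWeight-x-x (c i)
      ... | no  mᵢ≢cᵢ = ≤-trans (rowWeight-0-x (c i)) (rowWeight-≢ (m i) (c i) mᵢ≢cᵢ)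
    ... | no none =
      -- The head is always dropped: this makes `z` strictly lighter than `m`, at the cost of the
      -- head's weight in `few`.
      z , ≤-trans (+-mono-≤ far₀ (∑-mono-≤ far)) few ,
      below (+-mono-<-≤ (≤-<-trans (rowWeight-x-x {r} 0ᴿ) 0<m₀) (∑-mono-≤ near))
      where
      m≡c : ∀ i → 0 < rowWeight (m i) → rowWeight (m i) ≡ rowWeight (c i)
      m≡c i 0<mᵢ with rowWeight (m i) ≟ᴺ rowWeight (c i)
      ... | yes mᵢ≡cᵢ = mᵢ≡cᵢ
      ... | no  mᵢ≢cᵢ = contradiction (i , 0<mᵢ , mᵢ≢cᵢ) none

      z : Matrix (suc n) r
      z = 0ᴿ ∷ λ i → keep (0 <? rowWeight (m (suc i))) (c (suc i))

      near : ∀ i → rowWeight (z (suc i) -ᴿ 0ᴿ) ≤ rowWeight (m (suc i))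
      near i with 0 <? rowWeight (m (suc i))
      ... | yes 0<mᵢ = ≤-trans (rowWeight-x-0 (c (suc i))) (≤-reflexive (≡.sym (m≡c (suc i) 0<mᵢ)))
      ... | no  _    = rowWeight-x-x {r} 0ᴿ

      far₀ : rowWeight (0ᴿ -ᴿ c zero) ≤ rowWeight (m zero)
      far₀ = ≤-trans (rowWeight-0-x (c zero)) (≤-reflexive (≡.sym (m≡c zero 0<m₀)))

      far : ∀ i → rowWeight (z (suc i) -ᴿ c (suc i)) ≤ slack r (rowWeight (m (suc i)))
      far i with 0 <? rowWeight (m (suc i))
      ... | yes _    = rowWeight-x-x (c (suc i))
      ... | no  0≮mᵢ = ≤-trans (rowWeight-0-x (c (suc i)))
        (≤-trans (rowWeight≤r (c (suc i)))
          (≤-reflexive (cong (slack r) (≡.sym (n≤0⇒n≡0 (≮⇒≥ 0≮mᵢ))))))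

  -- Existence of a sticky vector.

  ∃-sticky : ∀ s r R → 2 ≤ s → 1 ≤ r → 1 ≤ R → ℤ.1ℤ ℤ.≤ δ s r R → R + 1 ≤ s * r →
             ∃ λ (m : Matrix s r) → Sticky R (Ball 0ᴹ R) m
  ∃-sticky (suc (suc n)) r@(suc r′) R (s≤s (s≤s _)) 1≤r 1≤R 1≤δ R<sr =
    m , sticky m
      (≡.trans (sum-cong-≗ m≡a) (≡.trans (cong (head +_) ∑rows) total))
      (subst (0 <_) (≡.sym (m≡a zero)) 1≤head)
      (subst (_≤ R) (≡.sym (≡.cong₂ _+_ (m≡a zero) (sum-cong-≗ (cong (slack r) ∘ m≡a ∘ suc)))) few)
    where
    open import Algebra.Properties.Monoid.Sum +-0-monoid using (sum-cong-≗)
    H = positiveHead r 1≤r (suc n) R (subst (_≤ suc (suc n) * r) (+-comm R 1) R<sr)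
    open PositiveHead H
    open Profile tail renaming (total to ∑rows)
    open ≤-Reasoning

    a : Vector ℕ (suc (suc n))
    a = head ∷ rows

    m : Matrix (suc (suc n)) r
    m i = unit (a i)

    m≡a : ∀ i → rowWeight (m i) ≡ a i
    m≡a zero    = rowWeight-unit head≤r
    m≡a (suc i) = rowWeight-unit (bounded i)

    few : head + ∑ (slack r ∘ rows) ≤ R
    few with size
    ... | inj₁ head≡1 = ≤-trans (+-mono-≤ (≤-reflexive head≡1) slacks)
      (δ≥1⇒zeroRows (suc n) r R 1≤R 1≤δ)
    -- The other rows are full, so the slack is 0. As `s ≥ 2` and `r ≥ 1` they weigh at least 1 out
    -- of `R + 1`, leaving at most `R` for the head.
    ... | inj₂ (nr≤R , rest≡nr) = begin
      head + ∑ (slack r ∘ rows)  ≤⟨ +-monoʳ-≤ head slacks ⟩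
      head + r * (suc n ∸ R)     ≡⟨ cong (λ k → head + r * k) (m≤n⇒m∸n≡0 (≤-trans (m≤m*n (suc n) r) nr≤R)) ⟩
      head + r * 0               ≡⟨ cong (head +_) (*-zeroʳ r) ⟩
      head + 0                   ≡⟨ +-identityʳ head ⟩
      head                       ≤⟨ m≤m+n head (r′ + n * r) ⟩
      head + (r′ + n * r)        ≡⟨ suc-injective head+nr≡1+R ⟩
      R                          ∎
      where
      head+nr≡1+R : suc (head + (r′ + n * r)) ≡ suc R
      head+nr≡1+R = ≡.trans (≡.sym (+-suc head _)) (≡.trans (cong (head +_) (≡.sym rest≡nr)) total)

  -- Perfect codes exclude sticky vectors.

  module _ {s r R a} (C : Pred (Matrix s r) a) (perfect : Perfect R C) where

    noSticky : ∀ {x₀} → x₀ ∈ C → (m : Matrix s r) → ¬ Sticky R (Ball 0ᴹ R) m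
    noSticky {x₀} x₀∈C m (m∈closure , m∉B) with proj₂ perfect (λ i j → m i j +ᶠ x₀ i j)
    ... | x , x∈C , p∈Bx with decidable (decidable _≟_) x x₀
    ... | yes x≈x₀ = m∉B (≤-trans (weight-cong λ i j →
        ≈-trans (x-0≈x _) (≈-trans (≈-sym (//-rightDividesʳ (x₀ i j) (m i j)))
          (+-congˡ (-‿cong (≈-sym (x≈x₀ i j)))))) p∈Bx)
    ... | no x≉x₀ with m∈closure (x -ᴹ x₀)
      (≤-trans (weight-cong λ i j → shift (m i j) (x i j) (x₀ i j)) p∈Bx)
      where
      shift : ∀ u v w → u - (v - w) ≈ (u +ᶠ w) - v
      shift u v w = ≈-trans (+-congˡ (⁻¹-anti-homo-// v w)) (≈-sym (+ᶠ-assoc u w (- v)))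
    -- Translated back by `x₀`, the common point `z` lies in the balls of both `x` and `x₀`.
    ... | z , z∈B[x-x₀] , z∈B[0] =
      proj₁ perfect x x₀ x∈C x₀∈C x≉x₀ {λ i j → z i j +ᶠ x₀ i j}
        ( ≤-trans (weight-cong λ i j → ≈-trans (+ᶠ-assoc _ _ _)
            (+-congˡ (≈-sym (⁻¹-anti-homo-// (x i j) (x₀ i j))))) z∈B[x-x₀]
        , ≤-trans (weight-cong λ i j → ≈-trans (//-rightDividesʳ (x₀ i j) (z i j))
            (≈-sym (x-0≈x _))) z∈B[0] )

    -- No weight exceeds `s * r`, so a larger or equal radius would put `x` into the balls of both
    -- codewords. This supplies the radius bound under which `∃-sticky` applies.
    R<diameter : ∀ {x y} → x ∈ C → y ∈ C → ¬ (x ≈ᴹ y) → R < s * r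
    R<diameter {x} {y} x∈C y∈C x≉y = ≰⇒> λ sr≤R →
      proj₁ perfect x y x∈C y∈C x≉y {x}
        (≤-trans (weight≤sr (x -ᴹ x)) sr≤R , ≤-trans (weight≤sr (x -ᴹ y)) sr≤R)
      where
      weight≤sr : ∀ (u : Matrix s r) → weight u ≤ s * r
      weight≤sr u = ∑-bound (rowWeight≤r ∘ u)

mainTheorem5 : ∀ {c ℓ a : Level} {q : ℕ} → IsPrimePower q → (F : FiniteField c ℓ q) → let open NRT F in
    (s r R : ℕ) → 2 ≤ s → 1 ≤ r → 1 ≤ R → ℤ.1ℤ ℤ.≤ δ s r R →
    (R + 1 ≤ s * r → ∃ λ (m : Matrix s r) → Sticky R (Ball 0ᴹ R) m) ×
    ((C : Pred (Matrix s r) a) → C Respects _≈ᴹ_ → ¬ (Perfect R C × NonTrivial C))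
mainTheorem5 _ F s r R 2≤s 1≤r 1≤R 1≤δ = ∃sticky , noPerfect
  where
  open NRT F
  ∃sticky = ∃-sticky F s r R 2≤s 1≤r 1≤R 1≤δ

  noPerfect : (C : Pred (Matrix s r) _) → C Respects _≈ᴹ_ → ¬ (Perfect R C × NonTrivial C)
  noPerfect C _ (perfect , (x , y , x∈C , y∈C , x≉y) , _)
    with m , m-sticky ← ∃sticky
           (subst (_≤ s * r) (+-comm 1 R) (R<diameter F C perfect x∈C y∈C x≉y)) =
    noSticky F C perfect x∈C m m-sticky
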